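{- For all parameters $t, s, m \geq \omega(1)$ and every collection $\mathcal{S} \subset \mathbb{F}_2^n$ such that $m \geq \omega(s \cdot 2^{5t})$ and $\log|\mathcal{S}| \geq 10^4 \cdot t \log s$, there exist $m$ linear functions from $\mathcal{S}$, i.e. $\mathcal{Q} = (M_1,\dots,M_m)$ with each $M_i \in \mathcal{S}$, such that $\mathcal{Q}$ does not admit a data structure using $s$ space and $t$ probes per query.
   Context: All logarithms are base 2. A vector $M_i \in \mathbb{F}_2^n$ is identified with the linear function $X \mapsto \langle M_i, X\rangle = \sum_k M_{i,k}X_k \in \mathbb{F}_2$ on $\mathbb{F}_2^n$. A (static, cell-probe, 1-bit cells) data structure for $\mathcal{Q} = (M_1,\dots,M_m)$ using $s$ space and $t$ probes per query consists of an arbitrary pre-processing function $U : \mathbb{F}_2^n \to \{0,1\}^s$ and, for every $i \in [m]$, a decision tree $\mathcal{T}_i$ of depth at most $t$ that adaptively probes coordinates of $U(X)$ (the address of each probe may depend on $i$ and on the previously read bits), whose leaves are labelled by answers, such that for every $X \in \mathbb{F}_2^n$ and every $i\in[m]$ the leaf reached by $\mathcal{T}_i$ on $U(X)$ is labelled by $\langle M_i, X\rangle$. The trees may depend arbitrarily on $M_1,\dots,M_m$; computation is free. Asymptotic notation: $n, t, s, m$ and $\mathcal{S}$ range over a sequence of instances; $t,s,m\ge\omega(1)$ means that $t,s,m$ tend to infinity along the sequence, and $m \geq \omega(s\cdot 2^{5t})$ means that $m/(s\cdot 2^{5t})$ tends to infinity; the conclusion is asserted for all sufficiently large instances of the sequence.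 -}

module Defs where

open import Data.Bool using (Bool; false; if_then_else_; _∧_; _xor_)
open import Data.Fin using (Fin)
open import Data.Nat using (ℕ; suc; _*_; _^_; _≤_; _⊔_)
open import Data.Product using (∃)
open import Data.Vec using (Vec; foldr′; lookup; zipWith)
open import Relation.Binary.PropositionalEquality using (_≡_)

-- The two-element field: addition is _xor_, multiplication is _∧_
-- (see xor-∧-commutativeRing in Data.Bool.Properties).
𝔽₂ : Set
𝔽₂ = Bool

𝔽₂^ : ℕ → Set
𝔽₂^ n = Vec 𝔽₂ n

⟨_,_⟩ : ∀ {n} → 𝔽₂^ n → 𝔽₂^ n → 𝔽₂
⟨ M , X ⟩ = foldr′ _xor_ false (zipWith _∧_ M X)

data DecisionTree (s : ℕ) : Set where
  answer : 𝔽₂ → DecisionTree s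
  probe  : (address : Fin s) (if0 if1 : DecisionTree s) → DecisionTree s

depth : ∀ {s} → DecisionTree s → ℕ
depth (answer _)       = 0
depth (probe _ T₀ T₁) = suc (depth T₀ ⊔ depth T₁)

run : ∀ {s} → DecisionTree s → Vec Bool s → 𝔽₂
run (answer a)       cells = a
run (probe j T₀ T₁) cells = if lookup cells j then run T₁ cells else run T₀ cells

record DataStructure {n m : ℕ} (Q : Fin m → 𝔽₂^ n) (s t : ℕ) : Set where
  field
    preprocess : 𝔽₂^ n → Vec Bool s
    tree       : Fin m → DecisionTree s
    depth≤t    : ∀ i → depth (tree i) ≤ t
    correct    : ∀ X i → run (tree i) (preprocess X) ≡ ⟨ Q i , X ⟩

Eventually : (ℕ → Set) → Set
Eventually P = ∃ λ K → ∀ k → K ≤ k → P k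

-- f ≥ ω(g) along a sequence of instances, i.e. f / g tends to infinity, with
-- the division cleared.  Taking g = 1 says that f tends to infinity.
_≥ω_ : (ℕ → ℕ) → (ℕ → ℕ) → Set
f ≥ω g = ∀ C → Eventually λ k → C * g k ≤ f k

-- log a ≥ c · log b, exponentiated so that it needs no real numbers.
log_≥_·log_ : ℕ → ℕ → ℕ → Set
log a ≥ c ·log b = b ^ c ≤ a

{-# OPTIONS --safe #-}
module Submission where

-- On any N sample points, a tree of depth t sends at least N / 2^t of them to one leaf, and
-- the query it answers is constant on those points.  If every set of N / 2^t samples leaves
-- fewer than 2q vectors of A ⊆ S constant on it, then the contents of the s cells on the N
-- samples (sN bits), a path to a leaf (t log 2s bits), the answer there and an index below 2q
-- determine each query, and there are too few such encodings to reach all of A^m.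
-- Good samples exist by averaging a potential: by pairwise independence a random x splits
-- each large A nearly evenly into the vectors with ⟨ M , x ⟩ = 0 and those with ⟨ M , x ⟩ = 1,
-- so that the p-th powers of the two sizes sum to far less than |A|^p.

import Data.Bool.Properties as Bool
import Data.List.Relation.Unary.All as All
import Data.Vec as Vec
import Data.Vec.Properties as Vec
open import Data.Bool using (Bool; true; false; not; _xor_; _∧_; if_then_else_)
open import Data.Fin using (Fin; zero; suc)
open import Data.Fin.Subset using (Subset; ∣_∣)
open import Data.List using (List; []; _∷_; _++_; length; map; filter; take; concatMap;
  allFin; cartesianProduct; cartesianProductWith)
open import Data.List.Membership.Propositional using (_∈_; _∉_; lose)
open import Data.List.Membership.Propositional.Properties
open import Data.List.Properties using (map-∘; map-++; length-++; length-++-sucʳ; length-map;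
  length-filter; length-tabulate; length-take)
open import Data.List.Relation.Binary.Sublist.Propositional using () renaming (lookup to ⊆-lookup)
open import Data.List.Relation.Binary.Sublist.Propositional.Properties using (take-⊆)
open import Data.List.Relation.Unary.All using (All; []; _∷_)
open import Data.List.Relation.Unary.AllPairs using ([]; _∷_)
open import Data.List.Relation.Unary.Any using (here; there)
open import Data.List.Relation.Unary.Unique.Propositional using (Unique)
open import Data.List.Relation.Unary.Unique.Propositional.Properties using (filter⁺; cartesianProductWith⁺; take⁺)
open import Data.Nat using (ℕ; zero; suc; _+_; _*_; _^_; _⊔_; _≤_; _<_; z≤n; s≤s; s≤s⁻¹;
  _≤?_; _≤ᵇ_; NonZero; >-nonZero; >-nonZero⁻¹)
open import Data.Nat.ListAction using (sum)
open import Data.Nat.ListAction.Properties using (sum-++)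
open import Data.Nat.Properties
open import Data.Nat.Tactic.RingSolver using (solve-∀)
open import Data.Product using (∃; Σ-syntax; _×_; _,_)
open import Data.Sum using (inj₁; inj₂; [_,_]′)
open import Data.Vec using (Vec; []; _∷_; lookup)
open import Function using (_∘_; id)
open import Relation.Binary using (DecidableEquality)
open import Relation.Binary.PropositionalEquality
open import Relation.Nullary using (¬_; does; yes; no; contradiction)
open import Relation.Nullary.Decidable using (dec-true; dec-false)
open import Defs

-- Finite sums over lists, averaging, and the enumeration of tuples.

∑ : {A : Set} → List A → (A → ℕ) → ℕ
∑ xs f = sum (map f xs)

module _ {A : Set} where

  ∑-mono : ∀ (xs : List A) {f g} → (∀ x → f x ≤ g x) → ∑ xs f ≤ ∑ xs g
  ∑-mono []       f≤g = z≤n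
  ∑-mono (x ∷ xs) f≤g = +-mono-≤ (f≤g x) (∑-mono xs f≤g)

  ∑-cong : ∀ (xs : List A) {f g} → (∀ x → f x ≡ g x) → ∑ xs f ≡ ∑ xs g
  ∑-cong []       f≡g = refl
  ∑-cong (x ∷ xs) f≡g = cong₂ _+_ (f≡g x) (∑-cong xs f≡g)

  ∑-+ : ∀ (xs : List A) f g → ∑ xs (λ x → f x + g x) ≡ ∑ xs f + ∑ xs g
  ∑-+ []       f g = refl
  ∑-+ (x ∷ xs) f g = trans (cong (f x + g x +_) (∑-+ xs f g))
    (+-middle (f x) (g x) (∑ xs f) (∑ xs g))
    where
    +-middle : ∀ a b c d → a + b + (c + d) ≡ a + c + (b + d)
    +-middle = solve-∀

  ∑-* : ∀ c (xs : List A) f → ∑ xs (λ x → c * f x) ≡ c * ∑ xs f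
  ∑-* c []       f = sym (*-zeroʳ c)
  ∑-* c (x ∷ xs) f = trans (cong (c * f x +_) (∑-* c xs f)) (sym (*-distribˡ-+ c (f x) _))

  ∑-const : ∀ (xs : List A) c → ∑ xs (λ _ → c) ≡ length xs * c
  ∑-const []       c = refl
  ∑-const (x ∷ xs) c = cong (c +_) (∑-const xs c)

  -- If the first value exceeds `c`, dropping it leaves the average of the rest at most `c`, so the
  -- search goes on; it cannot fail at the last element.
  ∑-average : ∀ (xs : List A) f c → 0 < length xs → ∑ xs f ≤ length xs * c → ∃ λ x → f x ≤ c
  ∑-average (x ∷ xs) f c _ ∑≤ with f x ≤? c
  ... | yes fx≤c = x , fx≤c
  ∑-average (x ∷ [])     f c _ ∑≤ | no fx≰c =
    contradiction (subst₂ _≤_ (+-identityʳ (f x)) (+-identityʳ c) ∑≤) fx≰c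
  ∑-average (x ∷ y ∷ xs) f c _ ∑≤ | no fx≰c =
    ∑-average (y ∷ xs) f c (s≤s z≤n)
      (+-cancelˡ-≤ c _ _ (≤-trans (+-monoˡ-≤ _ (<⇒≤ (≰⇒> fx≰c))) ∑≤))

∑-cartesianProductWith : ∀ {A B C : Set} (g : A → B → C) xs ys f →
  ∑ (cartesianProductWith g xs ys) f ≡ ∑ xs (λ x → ∑ ys (λ y → f (g x y)))
∑-cartesianProductWith g []       ys f = refl
∑-cartesianProductWith g (x ∷ xs) ys f = begin
  sum (map f (map (g x) ys ++ rest))        ≡⟨ cong sum (map-++ f (map (g x) ys) rest) ⟩
  sum (map f (map (g x) ys) ++ map f rest)  ≡⟨ sum-++ (map f (map (g x) ys)) (map f rest) ⟩
  ∑ (map (g x) ys) f + ∑ rest f             ≡⟨ cong₂ _+_ (cong sum (sym (map-∘ ys)))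
                                                 (∑-cartesianProductWith g xs ys f) ⟩
  ∑ ys (λ y → f (g x y)) + ∑ xs (λ x → ∑ ys (λ y → f (g x y))) ∎
  where
  open ≡-Reasoning
  rest = cartesianProductWith g xs ys

tuples : {A : Set} → List A → ∀ n → List (Vec A n)
tuples xs zero    = [] ∷ []
tuples xs (suc n) = cartesianProductWith _∷_ xs (tuples xs n)

length-cartesianProductWith : ∀ {A B C : Set} (g : A → B → C) xs ys →
  length (cartesianProductWith g xs ys) ≡ length xs * length ys
length-cartesianProductWith g []       ys = refl
length-cartesianProductWith g (x ∷ xs) ys = begin
  length (map (g x) ys ++ rest)       ≡⟨ length-++ (map (g x) ys) ⟩
  length (map (g x) ys) + length rest ≡⟨ cong₂ _+_ (length-map (g x) ys) (length-cartesianProductWith g xs ys) ⟩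
  length ys + length xs * length ys   ∎
  where
  open ≡-Reasoning
  rest = cartesianProductWith g xs ys

length-tuples : ∀ {A : Set} (xs : List A) n → length (tuples xs n) ≡ length xs ^ n
length-tuples xs zero    = refl
length-tuples xs (suc n) = trans (length-cartesianProductWith _∷_ xs (tuples xs n))
  (cong (length xs *_) (length-tuples xs n))

bools : List Bool
bools = false ∷ true ∷ []

points : ∀ n → List (𝔽₂^ n)
points = tuples bools

length-points : ∀ n → length (points n) ≡ 2 ^ n
length-points = length-tuples bools

-- Pairwise independence of the values at a random point.

δ : Bool → Bool → ℕ
δ a b = if a xor b then 0 else 1

δ-not : ∀ a b → δ (not a) (not b) ≡ δ a b
δ-not false false = refl
δ-not false true  = refl
δ-not true  false = refl
δ-not true  true  = refl

δ-complementˡ : ∀ a b → δ a b + δ (not a) b ≡ 1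
δ-complementˡ false false = refl
δ-complementˡ false true  = refl
δ-complementˡ true  false = refl
δ-complementˡ true  true  = refl

δ-complementʳ : ∀ a b → δ a b + δ a (not b) ≡ 1
δ-complementʳ false false = refl
δ-complementʳ false true  = refl
δ-complementʳ true  false = refl
δ-complementʳ true  true  = refl

∑-points : ∀ n (f : 𝔽₂^ (suc n) → ℕ) →
  ∑ (points (suc n)) f ≡ ∑ (points n) (λ x → f (false ∷ x) + f (true ∷ x))
∑-points n f = begin
  ∑ (points (suc n)) f         ≡⟨ ∑-cartesianProductWith _∷_ bools (points n) f ⟩
  ∑ (points n) (f ∘ (false ∷_)) + (∑ (points n) (f ∘ (true ∷_)) + 0)
                               ≡⟨ cong (∑ (points n) (f ∘ (false ∷_)) +_) (+-identityʳ _) ⟩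
  ∑ (points n) (f ∘ (false ∷_)) + ∑ (points n) (f ∘ (true ∷_))
                               ≡⟨ ∑-+ (points n) _ _ ⟨
  ∑ (points n) (λ x → f (false ∷ x) + f (true ∷ x)) ∎
  where open ≡-Reasoning

-- Induction on the coordinates, pairing the points that differ in the first one. If the heads of
-- the vectors are equal, the tails differ and both points of a pair agree or disagree together; if
-- the heads differ, exactly one point of each pair is an agreement.
distinct-agree-half : ∀ n {M M′ : 𝔽₂^ n} → M ≢ M′ →
  2 * ∑ (points n) (λ x → δ ⟨ M , x ⟩ ⟨ M′ , x ⟩) ≡ 2 ^ n
distinct-agree-half zero    {[]} {[]} M≢M′ = contradiction refl M≢M′
distinct-agree-half (suc n) {a ∷ M} {a′ ∷ M′} M≢M′ =
  trans (cong (2 *_) (∑-points n _)) (cong (2 *_) (go a a′ M≢M′))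
  where
  open ≡-Reasoning
  agree : 𝔽₂^ n → ℕ
  agree x = δ ⟨ M , x ⟩ ⟨ M′ , x ⟩

  same : M ≢ M′ → ∑ (points n) (λ x → agree x + agree x) ≡ 2 ^ n
  same ne = begin
    ∑ (points n) (λ x → agree x + agree x)    ≡⟨ ∑-+ (points n) agree agree ⟩
    ∑ (points n) agree + ∑ (points n) agree   ≡⟨ cong (∑ (points n) agree +_) (+-identityʳ _) ⟨
    2 * ∑ (points n) agree                    ≡⟨ distinct-agree-half n ne ⟩
    2 ^ n                                     ∎

  different : ∀ {f : 𝔽₂^ n → ℕ} → (∀ x → f x ≡ 1) → ∑ (points n) f ≡ 2 ^ n
  different f≡1 = begin
    _                          ≡⟨ ∑-cong (points n) f≡1 ⟩
    ∑ (points n) (λ _ → 1)     ≡⟨ ∑-const (points n) 1 ⟩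
    length (points n) * 1      ≡⟨ *-identityʳ _ ⟩
    length (points n)          ≡⟨ length-points n ⟩
    2 ^ n                      ∎

  go : ∀ a a′ → a ∷ M ≢ a′ ∷ M′ →
    ∑ (points n) (λ x → δ ⟨ a ∷ M , false ∷ x ⟩ ⟨ a′ ∷ M′ , false ∷ x ⟩
                      + δ ⟨ a ∷ M , true ∷ x ⟩ ⟨ a′ ∷ M′ , true ∷ x ⟩) ≡ 2 ^ n
  go false false ne = same (ne ∘ cong (false ∷_))
  go true  true  ne = trans
    (∑-cong (points n) (λ x → cong (agree x +_) (δ-not ⟨ M , x ⟩ ⟨ M′ , x ⟩)))
    (same (ne ∘ cong (true ∷_)))
  go false true  ne = different (λ x → δ-complementʳ ⟨ M , x ⟩ ⟨ M′ , x ⟩)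
  go true  false ne = different (λ x → δ-complementˡ ⟨ M , x ⟩ ⟨ M′ , x ⟩)

fibre : ∀ {n} → Bool → 𝔽₂^ n → List (𝔽₂^ n) → List (𝔽₂^ n)
fibre b x = filter (λ M → ⟨ M , x ⟩ Bool.≟ b)

∣fibre∣ : ∀ {n} → Bool → 𝔽₂^ n → List (𝔽₂^ n) → ℕ
∣fibre∣ b x A = length (fibre b x A)

∣fibre∣-∷ : ∀ {n} b (x : 𝔽₂^ n) M A → ∣fibre∣ b x (M ∷ A) ≡ δ ⟨ M , x ⟩ b + ∣fibre∣ b x A
∣fibre∣-∷ b x M A with ⟨ M , x ⟩ | b
... | false | false = refl
... | false | true  = refl
... | true  | false = refl
... | true  | true  = refl

fibres-partition : ∀ {n} (x : 𝔽₂^ n) A → ∣fibre∣ false x A + ∣fibre∣ true x A ≡ length A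
fibres-partition x []      = refl
fibres-partition x (M ∷ A) with ⟨ M , x ⟩
... | false = cong suc (fibres-partition x A)
... | true  = trans (+-suc _ _) (cong suc (fibres-partition x A))

-- Linearity: every vector of `A` differs from `M`, hence falls on the side of `M` for half of the
-- points.
∑-own-fibre : ∀ {n} (M : 𝔽₂^ n) A → All (M ≢_) A →
  2 * ∑ (points n) (λ x → ∣fibre∣ ⟨ M , x ⟩ x A) ≡ 2 ^ n * length A
∑-own-fibre {n} M []       []         =
  trans (cong (2 *_) (trans (∑-const (points n) 0) (*-zeroʳ (length (points n)))))
    (sym (*-zeroʳ (2 ^ n)))
∑-own-fibre {n} M (M′ ∷ A) (M≢M′ ∷ M∉A) = begin
  2 * ∑ (points n) (λ x → ∣fibre∣ ⟨ M , x ⟩ x (M′ ∷ A))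
    ≡⟨ cong (2 *_) (∑-cong (points n) (λ x → ∣fibre∣-∷ ⟨ M , x ⟩ x M′ A)) ⟩
  2 * ∑ (points n) (λ x → δ ⟨ M′ , x ⟩ ⟨ M , x ⟩ + ∣fibre∣ ⟨ M , x ⟩ x A)
    ≡⟨ cong (2 *_) (∑-+ (points n) _ _) ⟩
  2 * (∑ (points n) (λ x → δ ⟨ M′ , x ⟩ ⟨ M , x ⟩) + ∑ (points n) (λ x → ∣fibre∣ ⟨ M , x ⟩ x A))
    ≡⟨ *-distribˡ-+ 2 (∑ (points n) (λ x → δ ⟨ M′ , x ⟩ ⟨ M , x ⟩)) _ ⟩
  2 * ∑ (points n) (λ x → δ ⟨ M′ , x ⟩ ⟨ M , x ⟩) + 2 * ∑ (points n) (λ x → ∣fibre∣ ⟨ M , x ⟩ x A)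
    ≡⟨ cong₂ _+_ (distinct-agree-half n (M≢M′ ∘ sym)) (∑-own-fibre M A M∉A) ⟩
  2 ^ n + 2 ^ n * length A
    ≡⟨ *-suc (2 ^ n) (length A) ⟨
  2 ^ n * suc (length A) ∎
  where open ≡-Reasoning

-- The squares count ordered pairs of vectors that agree at `x`. With a the length of `A`, the a
-- diagonal pairs always agree and the a (a - 1) others at half of the points. In the induction, a
-- new `M` raises the square of its own side, of size u, by 1 + 2u.
∑-squares-of-fibres : ∀ {n} {A : List (𝔽₂^ n)} → Unique A →
  2 * ∑ (points n) (λ x → ∣fibre∣ false x A * ∣fibre∣ false x A + ∣fibre∣ true x A * ∣fibre∣ true x A)
    ≡ 2 ^ n * (length A * suc (length A))
∑-squares-of-fibres {n} {[]} [] =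
  trans (cong (2 *_) (trans (∑-const (points n) 0) (*-zeroʳ (length (points n)))))
    (sym (*-zeroʳ (2 ^ n)))
∑-squares-of-fibres {n} {M ∷ A} (M∉A ∷ A!) = begin
  2 * ∑ (points n) (squares (M ∷ A))
    ≡⟨ cong (2 *_) (∑-cong (points n) step) ⟩
  2 * ∑ (points n) (λ x → squares A x + (1 + 2 * ∣fibre∣ ⟨ M , x ⟩ x A))
    ≡⟨ cong (2 *_) (∑-+ (points n) _ _) ⟩
  2 * (∑ (points n) (squares A) + ∑ (points n) (λ x → 1 + 2 * ∣fibre∣ ⟨ M , x ⟩ x A))
    ≡⟨ cong (λ z → 2 * (∑ (points n) (squares A) + z)) (trans (∑-+ (points n) _ _)
        (cong₂ _+_ (trans (∑-const (points n) 1) (trans (*-identityʳ _) (length-points n)))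
          (trans (∑-* 2 (points n) _) (∑-own-fibre M A M∉A)))) ⟩
  2 * (∑ (points n) (squares A) + (2 ^ n + 2 ^ n * length A))
    ≡⟨ *-distribˡ-+ 2 (∑ (points n) (squares A)) _ ⟩
  2 * ∑ (points n) (squares A) + 2 * (2 ^ n + 2 ^ n * length A)
    ≡⟨ cong (_+ 2 * (2 ^ n + 2 ^ n * length A)) (∑-squares-of-fibres A!) ⟩
  2 ^ n * (length A * suc (length A)) + 2 * (2 ^ n + 2 ^ n * length A)
    ≡⟨ arithmetic (2 ^ n) (length A) ⟩
  2 ^ n * (suc (length A) * suc (suc (length A))) ∎
  where
  open ≡-Reasoning
  squares : List (𝔽₂^ n) → 𝔽₂^ n → ℕ
  squares A x = ∣fibre∣ false x A * ∣fibre∣ false x A + ∣fibre∣ true x A * ∣fibre∣ true x A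

  incrementˡ : ∀ u v → suc u * suc u + v * v ≡ u * u + v * v + (1 + 2 * u)
  incrementˡ = solve-∀

  incrementʳ : ∀ u v → u * u + suc v * suc v ≡ u * u + v * v + (1 + 2 * v)
  incrementʳ = solve-∀

  step : ∀ x → squares (M ∷ A) x ≡ squares A x + (1 + 2 * ∣fibre∣ ⟨ M , x ⟩ x A)
  step x with ⟨ M , x ⟩
  ... | false = incrementˡ (∣fibre∣ false x A) (∣fibre∣ true x A)
  ... | true  = incrementʳ (∣fibre∣ false x A) (∣fibre∣ true x A)

  arithmetic : ∀ v a → v * (a * suc a) + 2 * (v + v * a) ≡ v * (suc a * suc (suc a))
  arithmetic = solve-∀

-- Elementary inequalities between powers.

^-distribʳ-* : ∀ m n o → (m * n) ^ o ≡ m ^ o * n ^ o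
^-distribʳ-* m n zero    = refl
^-distribʳ-* m n (suc o) = trans (cong (m * n *_) (^-distribʳ-* m n o))
  ([m*n]*[o*p]≡[m*o]*[n*p] m n (m ^ o) (n ^ o))

[m+n]²≤2[m²+n²] : ∀ m n → (m + n) * (m + n) ≤ 2 * (m * m + n * n)
[m+n]²≤2[m²+n²] m n with ≤-total m n
... | inj₁ m≤n with k , refl ← m≤n⇒∃[o]m+o≡n m≤n =
  ≤-trans (m≤m+n _ (k * k)) (≤-reflexive (identity m k))
  where
  identity : ∀ m k → (m + (m + k)) * (m + (m + k)) + k * k ≡ 2 * (m * m + (m + k) * (m + k))
  identity = solve-∀
... | inj₂ n≤m with k , refl ← m≤n⇒∃[o]m+o≡n n≤m =
  ≤-trans (m≤m+n _ (k * k)) (≤-reflexive (identity n k))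
  where
  identity : ∀ n k → (n + k + n) * (n + k + n) + k * k ≡ 2 * ((n + k) * (n + k) + n * n)
  identity = solve-∀

-- A reverse Bernoulli inequality, (1 + 1/m)^k ≤ 1 + 2k/m with denominators cleared. Each further
-- factor adds 1/m + 2k/m², which is at most 2/m as long as 2k ≤ m.
[1+m]^k*m≤m^k*[m+2k] : ∀ m k → 2 * k ≤ m → suc m ^ k * m ≤ m ^ k * (m + 2 * k)
[1+m]^k*m≤m^k*[m+2k] m zero    _    = *-monoʳ-≤ 1 (m≤m+n m 0)
[1+m]^k*m≤m^k*[m+2k] m (suc k) 2k≤m = begin
  suc m * suc m ^ k * m            ≡⟨ *-assoc (suc m) (suc m ^ k) m ⟩
  suc m * (suc m ^ k * m)          ≤⟨ *-monoʳ-≤ (suc m) ([1+m]^k*m≤m^k*[m+2k] m k 2k≤m′) ⟩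
  suc m * (m ^ k * (m + 2 * k))    ≡⟨ expand m k (m ^ k) ⟩
  m ^ k * (m * (m + 2 * k) + m + 2 * k)
                                   ≤⟨ *-monoʳ-≤ (m ^ k) (+-monoʳ-≤ (m * (m + 2 * k) + m) 2k≤m′) ⟩
  m ^ k * (m * (m + 2 * k) + m + m)
                                   ≡⟨ collect m k (m ^ k) ⟩
  m * m ^ k * (m + 2 * suc k)      ∎
  where
  open ≤-Reasoning
  2k≤m′ : 2 * k ≤ m
  2k≤m′ = ≤-trans (*-monoʳ-≤ 2 (n≤1+n k)) 2k≤m
  expand : ∀ m k y → suc m * (y * (m + 2 * k)) ≡ y * (m * (m + 2 * k) + m + 2 * k)
  expand = solve-∀
  collect : ∀ m k y → y * (m * (m + 2 * k) + m + m) ≡ m * y * (m + 2 * suc k)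
  collect = solve-∀

[1+m]^k≤2*m^k : ∀ m k → .{{_ : NonZero m}} → 2 * k ≤ m → suc m ^ k ≤ 2 * m ^ k
[1+m]^k≤2*m^k m k 2k≤m = *-cancelʳ-≤ _ _ m (begin
  suc m ^ k * m            ≤⟨ [1+m]^k*m≤m^k*[m+2k] m k 2k≤m ⟩
  m ^ k * (m + 2 * k)      ≤⟨ *-monoʳ-≤ (m ^ k) (+-monoʳ-≤ m 2k≤m) ⟩
  m ^ k * (m + m)          ≡⟨ double m (m ^ k) ⟩
  2 * m ^ k * m            ∎)
  where
  open ≤-Reasoning
  double : ∀ m y → y * (m + m) ≡ 2 * y * m
  double = solve-∀

-- Choice of the samples by averaging a potential.

-- One bit `b` serves for all selected samples, because the samples that reach one leaf all receive
-- its answer.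
restrict : ∀ {n N} → Bool → List (𝔽₂^ n) → Vec (𝔽₂^ n) N → Subset N → List (𝔽₂^ n)
restrict b A []       []          = A
restrict b A (x ∷ xs) (true  ∷ J) = restrict b (fibre b x A) xs J
restrict b A (x ∷ xs) (false ∷ J) = restrict b A xs J

-- `shrink` says (7/8)^p ≤ 1/q: a part with at most 7/8 of the whole keeps at most a 1/q fraction of
-- its p-th power.
module Sampling (q p : ℕ) .{{_ : NonZero q}} (shrink : q * 7 ^ p ≤ 8 ^ p) where

  power-shrinks : ∀ u a → 8 * u ≤ 7 * a → q * u ^ p ≤ a ^ p
  power-shrinks u a 8u≤7a = *-cancelˡ-≤ (8 ^ p) {{m^n≢0 8 p}} (begin
    8 ^ p * (q * u ^ p)    ≡⟨ exchange (8 ^ p) q (u ^ p) ⟩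
    q * (8 ^ p * u ^ p)    ≡⟨ cong (q *_) (^-distribʳ-* 8 u p) ⟨
    q * (8 * u) ^ p        ≤⟨ *-monoʳ-≤ q (^-monoˡ-≤ p 8u≤7a) ⟩
    q * (7 * a) ^ p        ≡⟨ cong (q *_) (^-distribʳ-* 7 a p) ⟩
    q * (7 ^ p * a ^ p)    ≡⟨ *-assoc q (7 ^ p) (a ^ p) ⟨
    q * 7 ^ p * a ^ p      ≤⟨ *-monoˡ-≤ (a ^ p) shrink ⟩
    8 ^ p * a ^ p          ∎)
    where
    open ≤-Reasoning
    exchange : ∀ x y z → x * (y * z) ≡ y * (x * z)
    exchange = solve-∀

  private
    powers-of-parts-unbalanced : ∀ u v → let a = u + v in
      6 * (a * a) ≤ 8 * (u * u + v * v) →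
      q * (a * a) * (u ^ p + v ^ p) + 4 * q * (a * a) * a ^ p
        ≤ 2 * (a * a) * a ^ p + 8 * q * a ^ p * (u * u + v * v)
    powers-of-parts-unbalanced u v 6a²≤8s = begin
      q * (a * a) * (u ^ p + v ^ p) + 4 * q * (a * a) * a ^ p
        ≤⟨ +-monoˡ-≤ _ (*-monoʳ-≤ (q * (a * a))
             (+-mono-≤ (^-monoˡ-≤ p (m≤m+n u v)) (^-monoˡ-≤ p (m≤n+m v u)))) ⟩
      q * (a * a) * (a ^ p + a ^ p) + 4 * q * (a * a) * a ^ p
        ≡⟨ collect q (a * a) (a ^ p) ⟩
      q * a ^ p * (6 * (a * a))
        ≤⟨ *-monoʳ-≤ (q * a ^ p) 6a²≤8s ⟩
      q * a ^ p * (8 * (u * u + v * v))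
        ≡⟨ regroup q (a ^ p) (u * u + v * v) ⟩
      8 * q * a ^ p * (u * u + v * v)
        ≤⟨ m≤n+m _ _ ⟩
      2 * (a * a) * a ^ p + 8 * q * a ^ p * (u * u + v * v) ∎
      where
      open ≤-Reasoning
      a = u + v
      collect : ∀ q b y → q * b * (y + y) + 4 * q * b * y ≡ q * y * (6 * b)
      collect = solve-∀
      regroup : ∀ q y s → q * y * (8 * s) ≡ 8 * q * y * s
      regroup = solve-∀

    -- The threshold 7/8 works because its square 49/64 exceeds 48/64 = 3/4.
    large-part : ∀ w a → 7 * a ≤ 8 * w → 6 * (a * a) ≤ 8 * (w * w)
    large-part w a 7a≤8w = *-cancelˡ-≤ 8 (begin
      8 * (6 * (a * a))     ≡⟨ *-assoc 8 6 (a * a) ⟨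
      48 * (a * a)          ≤⟨ *-monoˡ-≤ (a * a) (n≤1+n 48) ⟩
      49 * (a * a)          ≡⟨ [m*n]*[o*p]≡[m*o]*[n*p] 7 a 7 a ⟨
      7 * a * (7 * a)       ≤⟨ *-mono-≤ 7a≤8w 7a≤8w ⟩
      8 * w * (8 * w)       ≡⟨ [m*n]*[o*p]≡[m*o]*[n*p] 8 w 8 w ⟩
      64 * (w * w)          ≡⟨ *-assoc 8 8 (w * w) ⟩
      8 * (8 * (w * w))     ∎)
      where open ≤-Reasoning

  -- If both parts are at most 7/8 of the whole, `shrink` bounds each power by `a ^ p` / q.
  -- Otherwise u² + v² ≥ 3a²/4, and the imbalance alone pays for the trivial bound `2 * a ^ p`.
  -- Since 2 (u² + v²) - a² = (u - v)², this is (u^p + v^p) / a^p ≤ 2/q + 4 ((u - v) / a)² with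
  -- denominators cleared.
  powers-of-parts : ∀ u v → let a = u + v in
    q * (a * a) * (u ^ p + v ^ p) + 4 * q * (a * a) * a ^ p
      ≤ 2 * (a * a) * a ^ p + 8 * q * a ^ p * (u * u + v * v)
  powers-of-parts u v with 8 * u ≤? 7 * (u + v) | 8 * v ≤? 7 * (u + v)
  ... | yes u-small | yes v-small = +-mono-≤ powers squares
    where
    a = u + v
    open ≤-Reasoning
    powers : q * (a * a) * (u ^ p + v ^ p) ≤ 2 * (a * a) * a ^ p
    powers = begin
      q * (a * a) * (u ^ p + v ^ p)        ≡⟨ regroup q (a * a) (u ^ p) (v ^ p) ⟩
      a * a * (q * u ^ p + q * v ^ p)      ≤⟨ *-monoʳ-≤ (a * a) (+-mono-≤
                                               (power-shrinks u a u-small)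
                                               (power-shrinks v a v-small)) ⟩
      a * a * (a ^ p + a ^ p)              ≡⟨ double (a * a) (a ^ p) ⟩
      2 * (a * a) * a ^ p                  ∎
      where
      regroup : ∀ q b x y → q * b * (x + y) ≡ b * (q * x + q * y)
      regroup = solve-∀
      double : ∀ b y → b * (y + y) ≡ 2 * b * y
      double = solve-∀
    squares : 4 * q * (a * a) * a ^ p ≤ 8 * q * a ^ p * (u * u + v * v)
    squares = begin
      4 * q * (a * a) * a ^ p                        ≡⟨ regroup q (a * a) (a ^ p) ⟩
      4 * q * a ^ p * (a * a)                        ≤⟨ *-monoʳ-≤ (4 * q * a ^ p) ([m+n]²≤2[m²+n²] u v) ⟩
      4 * q * a ^ p * (2 * (u * u + v * v))          ≡⟨ double q (a ^ p) (u * u + v * v) ⟩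
      8 * q * a ^ p * (u * u + v * v)                ∎
      where
      regroup : ∀ q b y → 4 * q * b * y ≡ 4 * q * y * b
      regroup = solve-∀
      double : ∀ q y s → 4 * q * y * (2 * s) ≡ 8 * q * y * s
      double = solve-∀
  ... | no u-large | _ = powers-of-parts-unbalanced u v
    (≤-trans (large-part u (u + v) (<⇒≤ (≰⇒> u-large))) (*-monoʳ-≤ 8 (m≤m+n (u * u) (v * v))))
  ... | _ | no v-large = powers-of-parts-unbalanced u v
    (≤-trans (large-part v (u + v) (<⇒≤ (≰⇒> v-large))) (*-monoʳ-≤ 8 (m≤n+m (v * v) (u * u))))

  -- Below 2q the splitting by a random point is too uneven, so such lists are ignored.
  potential : ℕ → ℕ
  potential a = if does (2 * q ≤? a) then a ^ p else 0

  potential≤^ : ∀ a → potential a ≤ a ^ p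
  potential≤^ a with 2 * q ≤ᵇ a
  ... | true  = ≤-refl
  ... | false = z≤n

  potential-large : ∀ {a} → 2 * q ≤ a → potential a ≡ a ^ p
  potential-large {a} 2q≤a rewrite dec-true (2 * q ≤? a) 2q≤a = refl

  potential-small : ∀ {a} → a < 2 * q → potential a ≡ 0
  potential-small {a} a<2q rewrite dec-false (2 * q ≤? a) (<⇒≱ a<2q) = refl

  -- Chebyshev's inequality: Σ (c₀ - c₁)² over all points is only 2 ^ n * a, where
  -- (c₀ - c₁)² = 2 (c₀² + c₁²) - a² is kept on the side where nothing is subtracted.
  potential-of-fibres : ∀ {n} {A : List (𝔽₂^ n)} → Unique A →
    q * ∑ (points n) (λ x → potential (∣fibre∣ false x A) + potential (∣fibre∣ true x A))
      ≤ 4 * (2 ^ n * potential (length A))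
  potential-of-fibres {n} {A} A! with 2 * q ≤? length A
  -- The fibres of a short list are short too, so all potentials vanish.
  ... | no 2q≰a = begin
    q * ∑ (points n) (λ x → potential (∣fibre∣ false x A) + potential (∣fibre∣ true x A))
      ≡⟨ cong (q *_) (∑-cong (points n) (λ x → cong₂ _+_
           (potential-small (≤-<-trans (length-filter _ A) (≰⇒> 2q≰a)))
           (potential-small (≤-<-trans (length-filter _ A) (≰⇒> 2q≰a))))) ⟩
    q * ∑ (points n) (λ _ → 0)
      ≡⟨ cong (q *_) (trans (∑-const (points n) 0) (*-zeroʳ (length (points n)))) ⟩
    q * 0
      ≡⟨ *-zeroʳ q ⟩
    0
      ≤⟨ z≤n ⟩
    4 * (2 ^ n * potential (length A)) ∎
    where open ≤-Reasoning
  ... | yes 2q≤a = *-cancelˡ-≤ (a * a) {{a²≢0}} (+-cancelʳ-≤ (4 * q * (a * a) * a ^ p * 2 ^ n) _ _ (begin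
    a * a * (q * ∑ (points n) (λ x → potential (c₀ x) + potential (c₁ x))) + excess * 2 ^ n
      ≤⟨ +-mono-≤ (*-monoʳ-≤ (a * a) (*-monoʳ-≤ q (∑-mono (points n)
           (λ x → +-mono-≤ (potential≤^ (c₀ x)) (potential≤^ (c₁ x)))))) (≤-reflexive (*-comm excess (2 ^ n))) ⟩
    a * a * (q * ∑ (points n) powers) + 2 ^ n * excess
      ≡⟨ cong₂ _+_ (trans (reassoc (a * a) q _) (sym (∑-* (q * (a * a)) (points n) powers)))
           (sym (trans (∑-const (points n) excess) (cong (_* excess) (length-points n)))) ⟩
    ∑ (points n) (λ x → q * (a * a) * powers x) + ∑ (points n) (λ _ → excess)
      ≡⟨ ∑-+ (points n) _ _ ⟨
    ∑ (points n) (λ x → q * (a * a) * powers x + excess)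
      ≤⟨ ∑-mono (points n) pointwise ⟩
    ∑ (points n) (λ x → 2 * (a * a) * a ^ p + 8 * q * a ^ p * squares x)
      ≡⟨ ∑-+ (points n) _ _ ⟩
    ∑ (points n) (λ _ → 2 * (a * a) * a ^ p) + ∑ (points n) (λ x → 8 * q * a ^ p * squares x)
      ≡⟨ cong₂ _+_ (trans (∑-const (points n) _) (cong (_* (2 * (a * a) * a ^ p)) (length-points n)))
           (∑-* (8 * q * a ^ p) (points n) squares) ⟩
    2 ^ n * (2 * (a * a) * a ^ p) + 8 * q * a ^ p * ∑ (points n) squares
      ≡⟨ cong (2 ^ n * (2 * (a * a) * a ^ p) +_) (trans (halve q (a ^ p) _)
           (cong (4 * q * a ^ p *_) (∑-squares-of-fibres A!))) ⟩
    2 ^ n * (2 * (a * a) * a ^ p) + 4 * q * a ^ p * (2 ^ n * (a * suc a))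
      ≡⟨ split q a (a ^ p) (2 ^ n) ⟩
    2 ^ n * a ^ p * (2 * (a * a) + 2 * (2 * q) * a) + excess * 2 ^ n
      -- The threshold `2 * q` enters here: it makes the variance term 4qa at most 2a², as large as
      -- the term from balanced splits.
      ≤⟨ +-monoˡ-≤ _ (*-monoʳ-≤ (2 ^ n * a ^ p) (+-monoʳ-≤ (2 * (a * a))
           (*-monoˡ-≤ a (*-monoʳ-≤ 2 2q≤a)))) ⟩
    2 ^ n * a ^ p * (2 * (a * a) + 2 * a * a) + excess * 2 ^ n
      ≡⟨ cong (_+ excess * 2 ^ n) (collect a (a ^ p) (2 ^ n)) ⟩
    a * a * (4 * (2 ^ n * a ^ p)) + excess * 2 ^ n
      ≡⟨ cong (λ y → a * a * (4 * (2 ^ n * y)) + excess * 2 ^ n) (potential-large 2q≤a) ⟨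
    a * a * (4 * (2 ^ n * potential a)) + excess * 2 ^ n ∎))
    where
    open ≤-Reasoning
    a = length A
    c₀ c₁ powers squares : 𝔽₂^ n → ℕ
    c₀ x = ∣fibre∣ false x A
    c₁ x = ∣fibre∣ true x A
    powers x = c₀ x ^ p + c₁ x ^ p
    squares x = c₀ x * c₀ x + c₁ x * c₁ x
    excess = 4 * q * (a * a) * a ^ p

    a≢0 : NonZero a
    a≢0 = >-nonZero (<-≤-trans (>-nonZero⁻¹ (2 * q) {{m*n≢0 2 q}}) 2q≤a)

    a²≢0 : NonZero (a * a)
    a²≢0 = m*n≢0 a a {{a≢0}} {{a≢0}}

    pointwise : ∀ x → q * (a * a) * powers x + excess
                    ≤ 2 * (a * a) * a ^ p + 8 * q * a ^ p * squares x
    pointwise x = subst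
      (λ a → q * (a * a) * powers x + 4 * q * (a * a) * a ^ p
           ≤ 2 * (a * a) * a ^ p + 8 * q * a ^ p * squares x)
      (fibres-partition x A) (powers-of-parts (c₀ x) (c₁ x))

    reassoc : ∀ b q s → b * (q * s) ≡ q * b * s
    reassoc = solve-∀
    halve : ∀ q y s → 8 * q * y * s ≡ 4 * q * y * (2 * s)
    halve = solve-∀
    split : ∀ q a y v → v * (2 * (a * a) * y) + 4 * q * y * (v * (a * suc a))
                      ≡ v * y * (2 * (a * a) + 2 * (2 * q) * a) + 4 * q * (a * a) * y * v
    split = solve-∀
    collect : ∀ a y v → v * y * (2 * (a * a) + 2 * a * a) ≡ a * a * (4 * (v * y))
    collect = solve-∀

  -- The potentials of all restrictions of A to subsets J of the samples, with all values
  -- prescribed on J, summed with weight 4 ^ ∣ J ∣.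
  Φ : ∀ {n N} → List (𝔽₂^ n) → Vec (𝔽₂^ n) N → ℕ
  Φ A []       = potential (length A)
  Φ A (x ∷ xs) = Φ A xs + 4 * (Φ (fibre false x A) xs + Φ (fibre true x A) xs)

  -- `Φ` is a sum of nonnegative terms, and prescribing the value `b` throughout `J` is one of them.
  restrict≤Φ : ∀ {n N} b A (xs : Vec (𝔽₂^ n) N) J →
    4 ^ ∣ J ∣ * potential (length (restrict b A xs J)) ≤ Φ A xs
  restrict≤Φ b     A []       []          = ≤-reflexive (*-identityˡ _)
  restrict≤Φ b     A (x ∷ xs) (false ∷ J) = ≤-trans (restrict≤Φ b A xs J) (m≤m+n _ _)
  restrict≤Φ b     A (x ∷ xs) (true  ∷ J) = begin
    4 * 4 ^ ∣ J ∣ * potential (length (restrict b (fibre b x A) xs J))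
      ≡⟨ *-assoc 4 (4 ^ ∣ J ∣) _ ⟩
    4 * (4 ^ ∣ J ∣ * potential (length (restrict b (fibre b x A) xs J)))
      ≤⟨ *-monoʳ-≤ 4 (≤-trans (restrict≤Φ b (fibre b x A) xs J) (one-of-both b)) ⟩
    4 * (Φ (fibre false x A) xs + Φ (fibre true x A) xs)
      ≤⟨ m≤n+m _ (Φ A xs) ⟩
    Φ A (x ∷ xs) ∎
    where
    open ≤-Reasoning
    one-of-both : ∀ b → Φ (fibre b x A) xs ≤ Φ (fibre false x A) xs + Φ (fibre true x A) xs
    one-of-both false = m≤m+n _ _
    one-of-both true  = m≤n+m _ _

  module _ {D : ℕ} (16D≤q : 16 * D ≤ q) where

    -- Each sample multiplies the average of `Φ` by at most 1 + 1/D: leaving it out of `J` keeps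
    -- `A`, while including it costs the weight 4 times the factor 4/q from `potential-of-fibres`,
    -- and 16/q ≤ 1/D. The induction hypothesis is applied to `A` and to both fibres.
    ∑-Φ : ∀ {n} N {A : List (𝔽₂^ n)} → Unique A →
      D ^ N * ∑ (tuples (points n) N) (Φ A) ≤ suc D ^ N * (2 ^ n) ^ N * potential (length A)
    ∑-Φ {n} zero    {A} A! = ≤-reflexive (cong (1 *_) (+-identityʳ _))
    ∑-Φ {n} (suc N) {A} A! = begin
      D * D ^ N * ∑ (tuples (points n) (suc N)) (Φ A)
        ≡⟨ *-assoc D (D ^ N) _ ⟩
      D * (D ^ N * ∑ (tuples (points n) (suc N)) (Φ A))
        ≡⟨ cong (λ z → D * (D ^ N * z)) (trans
             (∑-cartesianProductWith _∷_ (points n) (tuples (points n) N) (Φ A))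
             (∑-cong (points n) expand)) ⟩
      D * (D ^ N * ∑ (points n) (λ x → T A + 4 * (T (A₀ x) + T (A₁ x))))
        ≡⟨ cong (D *_) (sym (∑-* (D ^ N) (points n) _)) ⟩
      D * ∑ (points n) (λ x → D ^ N * (T A + 4 * (T (A₀ x) + T (A₁ x))))
        ≤⟨ *-monoʳ-≤ D (∑-mono (points n) bound) ⟩
      D * ∑ (points n) (λ x → G * (φ A + 4 * (φ (A₀ x) + φ (A₁ x))))
        ≡⟨ cong (D *_) (∑-* G (points n) _) ⟩
      D * (G * ∑ (points n) (λ x → φ A + 4 * (φ (A₀ x) + φ (A₁ x))))
        ≡⟨ cong (λ z → D * (G * z)) (trans (∑-+ (points n) _ _) (cong₂ _+_
             (trans (∑-const (points n) _) (cong (_* φ A) (length-points n)))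
             (∑-* 4 (points n) _))) ⟩
      D * (G * (2 ^ n * φ A + 4 * H))
        ≡⟨ distribute D G (2 ^ n * φ A) H ⟩
      G * (D * (2 ^ n * φ A) + 4 * D * H)
        ≤⟨ *-monoʳ-≤ G (+-monoʳ-≤ (D * (2 ^ n * φ A)) halving) ⟩
      G * (D * (2 ^ n * φ A) + 2 ^ n * φ A)
        ≡⟨ collect D (suc D ^ N) ((2 ^ n) ^ N) (2 ^ n) (φ A) ⟩
      suc D * suc D ^ N * (2 ^ n * (2 ^ n) ^ N) * φ A ∎
      where
      open ≤-Reasoning
      φ T : List (𝔽₂^ n) → ℕ
      φ B = potential (length B)
      T B = ∑ (tuples (points n) N) (Φ B)
      A₀ A₁ : 𝔽₂^ n → List (𝔽₂^ n)
      A₀ x = fibre false x A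
      A₁ x = fibre true x A
      G H : ℕ
      G = suc D ^ N * (2 ^ n) ^ N
      H = ∑ (points n) (λ x → φ (A₀ x) + φ (A₁ x))

      expand : ∀ x → ∑ (tuples (points n) N) (λ xs → Φ A (x ∷ xs)) ≡ T A + 4 * (T (A₀ x) + T (A₁ x))
      expand x = trans (∑-+ (tuples (points n) N) _ _)
        (cong (T A +_) (trans (∑-* 4 (tuples (points n) N) _)
          (cong (4 *_) (∑-+ (tuples (points n) N) _ _))))

      bound : ∀ x → D ^ N * (T A + 4 * (T (A₀ x) + T (A₁ x))) ≤ G * (φ A + 4 * (φ (A₀ x) + φ (A₁ x)))
      bound x = begin
        D ^ N * (T A + 4 * (T (A₀ x) + T (A₁ x)))
          ≡⟨ inside (D ^ N) (T A) (T (A₀ x)) (T (A₁ x)) ⟩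
        D ^ N * T A + 4 * (D ^ N * T (A₀ x) + D ^ N * T (A₁ x))
          ≤⟨ +-mono-≤ (∑-Φ N A!) (*-monoʳ-≤ 4 (+-mono-≤
               (∑-Φ N (filter⁺ _ A!)) (∑-Φ N (filter⁺ _ A!)))) ⟩
        G * φ A + 4 * (G * φ (A₀ x) + G * φ (A₁ x))
          ≡⟨ inside G (φ A) (φ (A₀ x)) (φ (A₁ x)) ⟨
        G * (φ A + 4 * (φ (A₀ x) + φ (A₁ x))) ∎
        where
        inside : ∀ g a b c → g * (a + 4 * (b + c)) ≡ g * a + 4 * (g * b + g * c)
        inside = solve-∀

      halving : 4 * D * H ≤ 2 ^ n * φ A
      halving = *-cancelˡ-≤ 4 (begin
        4 * (4 * D * H)       ≡⟨ sixteen D H ⟩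
        16 * D * H            ≤⟨ *-monoˡ-≤ H 16D≤q ⟩
        q * H                 ≤⟨ potential-of-fibres A! ⟩
        4 * (2 ^ n * φ A)     ∎)
        where
        sixteen : ∀ d h → 4 * (4 * d * h) ≡ 16 * d * h
        sixteen = solve-∀

      distribute : ∀ d g y h → d * (g * (y + 4 * h)) ≡ g * (d * y + 4 * d * h)
      distribute = solve-∀
      collect : ∀ d e w v y → e * w * (d * (v * y) + v * y) ≡ suc d * e * (v * w) * y
      collect = solve-∀

    ∃-Φ-small : ∀ {n} N {A : List (𝔽₂^ n)} → Unique A →
      ∃ λ (xs : Vec (𝔽₂^ n) N) → D ^ N * Φ A xs ≤ suc D ^ N * potential (length A)
    ∃-Φ-small {n} N {A} A! = ∑-average (tuples (points n) N) (λ xs → D ^ N * Φ A xs) _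
      (subst (0 <_) (sym length-samples) (m^n>0 (2 ^ n) {{m^n≢0 2 n}} N)) (begin
        ∑ (tuples (points n) N) (λ xs → D ^ N * Φ A xs)
          ≡⟨ ∑-* (D ^ N) (tuples (points n) N) (Φ A) ⟩
        D ^ N * ∑ (tuples (points n) N) (Φ A)
          ≤⟨ ∑-Φ N A! ⟩
        suc D ^ N * (2 ^ n) ^ N * potential (length A)
          ≡⟨ regroup (suc D ^ N) ((2 ^ n) ^ N) _ ⟩
        (2 ^ n) ^ N * (suc D ^ N * potential (length A))
          ≡⟨ cong (_* (suc D ^ N * potential (length A))) length-samples ⟨
        length (tuples (points n) N) * (suc D ^ N * potential (length A)) ∎)
      where
      open ≤-Reasoning
      length-samples : length (tuples (points n) N) ≡ (2 ^ n) ^ N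
      length-samples = trans (length-tuples (points n) N) (cong (_^ N) (length-points n))
      regroup : ∀ e w y → e * w * y ≡ w * (e * y)
      regroup = solve-∀

    -- Put r = κp. As (1 + 1/D)^k ≤ 2 and there are kr samples, some choice has `Φ` at most 2^r
    -- times the p-th power of the length of `A`, that is 4^r. If at least 2q vectors survived on
    -- some `J` of size at least r, the weight of `J` would force the p-th power of their number
    -- down to 1, although 2q ≥ 2.
    ∃-sample : ∀ {n} k κ {A : List (𝔽₂^ n)} .{{_ : NonZero D}} .{{_ : NonZero p}} →
      2 * k ≤ D → Unique A → length A ≡ 2 ^ κ →
      ∃ λ (xs : Vec (𝔽₂^ n) (k * (κ * p))) →
        ∀ b J → κ * p ≤ ∣ J ∣ → length (restrict b A xs J) < 2 * q
    ∃-sample {n} k κ {A} 2k≤D A! ∣A∣≡2^κ with xs , Φ-small ← ∃-Φ-small (k * (κ * p)) A! =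
      xs , λ b J r≤∣J∣ → ≰⇒> (λ 2q≤ℓ → <⇒≱ (1<ℓ^p b J 2q≤ℓ) (ℓ^p≤1 b J r≤∣J∣ 2q≤ℓ))
      where
      open ≤-Reasoning
      r = κ * p
      N = k * r
      ℓ : Bool → Subset N → ℕ
      ℓ b J = length (restrict b A xs J)

      1<ℓ^p : ∀ b J → 2 * q ≤ ℓ b J → 1 < ℓ b J ^ p
      1<ℓ^p b J 2q≤ℓ = begin-strict
        1           ≡⟨ ^-zeroˡ p ⟨
        1 ^ p       <⟨ ^-monoˡ-< p (<-≤-trans (*-monoʳ-≤ 2 (>-nonZero⁻¹ q)) 2q≤ℓ) ⟩
        ℓ b J ^ p   ∎

      [1+D]^N≤2^r*D^N : suc D ^ N ≤ 2 ^ r * D ^ N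
      [1+D]^N≤2^r*D^N = begin
        suc D ^ (k * r)     ≡⟨ ^-*-assoc (suc D) k r ⟨
        (suc D ^ k) ^ r     ≤⟨ ^-monoˡ-≤ r ([1+m]^k≤2*m^k D k 2k≤D) ⟩
        (2 * D ^ k) ^ r     ≡⟨ ^-distribʳ-* 2 (D ^ k) r ⟩
        2 ^ r * (D ^ k) ^ r ≡⟨ cong (2 ^ r *_) (^-*-assoc D k r) ⟩
        2 ^ r * D ^ N       ∎

      ℓ^p≤1 : ∀ b J → r ≤ ∣ J ∣ → 2 * q ≤ ℓ b J → ℓ b J ^ p ≤ 1
      ℓ^p≤1 b J r≤∣J∣ 2q≤ℓ =
        *-cancelˡ-≤ (4 ^ ∣ J ∣) {{m^n≢0 4 ∣ J ∣}} (*-cancelˡ-≤ (D ^ N) {{m^n≢0 D N}} (begin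
          D ^ N * (4 ^ ∣ J ∣ * ℓ b J ^ p)
            ≡⟨ cong (λ y → D ^ N * (4 ^ ∣ J ∣ * y)) (potential-large 2q≤ℓ) ⟨
          D ^ N * (4 ^ ∣ J ∣ * potential (ℓ b J))
            ≤⟨ *-monoʳ-≤ (D ^ N) (restrict≤Φ b A xs J) ⟩
          D ^ N * Φ A xs
            ≤⟨ Φ-small ⟩
          suc D ^ N * potential (length A)
            ≤⟨ *-mono-≤ [1+D]^N≤2^r*D^N (potential≤^ (length A)) ⟩
          2 ^ r * D ^ N * length A ^ p
            ≡⟨ cong (λ a → 2 ^ r * D ^ N * a ^ p) ∣A∣≡2^κ ⟩
          2 ^ r * D ^ N * (2 ^ κ) ^ p
            ≡⟨ cong (2 ^ r * D ^ N *_) (^-*-assoc 2 κ p) ⟩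
          2 ^ r * D ^ N * 2 ^ r
            ≡⟨ regroup (2 ^ r) (D ^ N) ⟩
          D ^ N * (2 ^ r * 2 ^ r * 1)
            ≡⟨ cong (λ y → D ^ N * (y * 1)) (^-distribʳ-* 2 2 r) ⟨
          D ^ N * (4 ^ r * 1)
            ≤⟨ *-monoʳ-≤ (D ^ N) (*-monoˡ-≤ 1 (^-monoʳ-≤ 4 r≤∣J∣)) ⟩
          D ^ N * (4 ^ ∣ J ∣ * 1) ∎))
        where
        regroup : ∀ x d → x * d * x ≡ d * (x * x * 1)
        regroup = solve-∀

-- Pigeonhole principle and membership in lists of tuples.

length-concatMap-≤ : ∀ {A B : Set} (f : A → List B) {c} → (∀ x → length (f x) ≤ c) →
  ∀ xs → length (concatMap f xs) ≤ length xs * c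
length-concatMap-≤ f f≤c []       = z≤n
length-concatMap-≤ f f≤c (x ∷ xs) = ≤-trans (≤-reflexive (length-++ (f x)))
  (+-mono-≤ (f≤c x) (length-concatMap-≤ f f≤c xs))

-- Pigeonhole: a head that occurs in `ys` is cut out of it, and the inequality survives for the
-- tail. The element then found in the tail is not the removed one, because the list has no
-- repetitions.
unique-∉ : ∀ {A : Set} → DecidableEquality A → ∀ {xs : List A} → Unique xs →
  ∀ ys → length ys < length xs → ∃ λ x → x ∈ xs × x ∉ ys
unique-∉ _≟_ {x ∷ xs} (x∉xs ∷ xs!) ys ∣ys∣<∣xs∣ with x ∈? ys
  where open import Data.List.Membership.DecPropositional _≟_ using (_∈?_)
... | no x∉ys = x , here refl , x∉ys
... | yes x∈ys with as , bs , refl ← ∈-∃++ x∈ys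
    with z , z∈xs , z∉ ← unique-∉ _≟_ xs! (as ++ bs)
           (subst (_≤ length xs) (length-++-sucʳ as x bs) (s≤s⁻¹ ∣ys∣<∣xs∣))
  = z , there z∈xs , λ z∈ → [ z∉ ∘ ∈-++⁺ˡ , tail ]′ (∈-++⁻ as z∈)
  where
  tail : z ∉ x ∷ bs
  tail (here refl)  = All.lookup x∉xs z∈xs refl
  tail (there z∈bs) = z∉ (∈-++⁺ʳ as z∈bs)

module _ {A : Set} {xs : List A} where

  tuples-unique : Unique xs → ∀ n → Unique (tuples xs n)
  tuples-unique xs! zero    = [] ∷ []
  tuples-unique xs! (suc n) = cartesianProductWith⁺ _∷_ Vec.∷-injective xs! (tuples-unique xs! n)

  ∈-tuples⁺ : ∀ {n} (v : Vec A n) → (∀ i → lookup v i ∈ xs) → v ∈ tuples xs n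
  ∈-tuples⁺ []      v⊆xs = here refl
  ∈-tuples⁺ (x ∷ v) v⊆xs = ∈-cartesianProductWith⁺ _∷_ (v⊆xs zero) (∈-tuples⁺ v (v⊆xs ∘ suc))

  ∈-tuples⁻ : ∀ {n} (v : Vec A n) → v ∈ tuples xs n → ∀ i → lookup v i ∈ xs
  ∈-tuples⁻ {suc n} v v∈ i with x , w , x∈xs , w∈ , refl ← ∈-cartesianProductWith⁻ _∷_ xs (tuples xs n) v∈
    with i
  ... | zero  = x∈xs
  ... | suc j = ∈-tuples⁻ w w∈ j

-- Leaves of a decision tree reached by many samples.

-- A leaf is described by the probed addresses and the bits read there, which makes sense without
-- the tree; so all possible leaves can be listed beforehand.
Path : ℕ → ℕ → Set
Path s t = Vec (Fin s × Bool) t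

follows : ∀ {s t} → Path s t → Vec Bool s → Bool
follows []            cells = true
follows ((j , c) ∷ π) cells = does (lookup cells j Bool.≟ c) ∧ follows π cells

steps : ∀ s → List (Fin s × Bool)
steps s = cartesianProduct (allFin s) bools

paths : ∀ s t → List (Path s t)
paths s = tuples (steps s)

∈-bools : ∀ b → b ∈ bools
∈-bools false = here refl
∈-bools true  = there (here refl)

∈-paths : ∀ {s t} (π : Path s t) → π ∈ paths s t
∈-paths π = ∈-tuples⁺ π (λ i → ∈-cartesianProduct⁺ (∈-allFin _) (∈-bools _))

length-paths : ∀ s t → length (paths s t) ≡ (s * 2) ^ t
length-paths s t = trans (length-tuples (steps s) t)
  (cong (_^ t) (trans (length-cartesianProductWith _,_ (allFin s) bools)
    (cong (_* 2) (length-tabulate {n = s} id))))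

module _ {s N : ℕ} (W : Vec (Vec Bool s) N) where

  -- `Vec.map P W` is a subset of the samples, of the kind that `restrict` takes as its argument.
  hits : (Vec Bool s → Bool) → ℕ
  hits P = ∣ Vec.map P W ∣

  hits-cong : ∀ {P P′} → (∀ w → P w ≡ P′ w) → hits P ≡ hits P′
  hits-cong P≗P′ = cong ∣_∣ (Vec.map-cong P≗P′ W)

hits-split : ∀ {s N} (W : Vec (Vec Bool s) N) (P : Vec Bool s → Bool) j →
  hits W P ≡ hits W (λ w → P w ∧ does (lookup w j Bool.≟ false))
           + hits W (λ w → P w ∧ does (lookup w j Bool.≟ true))
hits-split []      P j = refl
hits-split (w ∷ W) P j with P w | lookup w j
... | false | _     = hits-split W P j
... | true  | false = cong suc (hits-split W P j)
... | true  | true  = trans (cong suc (hits-split W P j)) (sym (+-suc _ _))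

majority : ∀ {s N} (W : Vec (Vec Bool s) N) (P : Vec Bool s → Bool) j →
  ∃ λ c → hits W P ≤ 2 * hits W (λ w → P w ∧ does (lookup w j Bool.≟ c))
majority W P j with ≤-total (hits W (λ w → P w ∧ does (lookup w j Bool.≟ false)))
                            (hits W (λ w → P w ∧ does (lookup w j Bool.≟ true)))
... | inj₁ h₀≤h₁ = true  , ≤-trans (≤-reflexive (hits-split W P j))
  (+-mono-≤ h₀≤h₁ (≤-reflexive (sym (+-identityʳ _))))
... | inj₂ h₁≤h₀ = false , ≤-trans (≤-reflexive (hits-split W P j))
  (+-monoʳ-≤ _ (≤-trans h₁≤h₀ (≤-reflexive (sym (+-identityʳ _)))))

-- Paths all have length t, so a leaf at a smaller depth is extended by probes of an arbitrary cell.
heavy-path : ∀ {s N} t (T : DecisionTree (suc s)) → depth T ≤ t →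
  (W : Vec (Vec Bool (suc s)) N) (P : Vec Bool (suc s) → Bool) →
  Σ[ π ∈ Path (suc s) t ] Σ[ b ∈ Bool ]
    (∀ w → follows π w ≡ true → run T w ≡ b) × hits W P ≤ 2 ^ t * hits W (λ w → P w ∧ follows π w)
heavy-path zero (answer b) _ W P = [] , b , (λ _ _ → refl) ,
  ≤-reflexive (trans (hits-cong W (λ w → sym (Bool.∧-identityʳ (P w)))) (sym (*-identityˡ _)))
heavy-path {s} {N} (suc t) T depth≤ W P = go T depth≤
  where
  open ≤-Reasoning
  Conclusion : DecisionTree (suc s) → Set
  Conclusion T = Σ[ π ∈ Path (suc s) (suc t) ] Σ[ b ∈ Bool ]
    (∀ w → follows π w ≡ true → run T w ≡ b) × hits W P ≤ 2 ^ suc t * hits W (λ w → P w ∧ follows π w)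

  extend : ∀ T (T′ : DecisionTree (suc s)) j c → depth T′ ≤ t →
    (∀ w → lookup w j ≡ c → run T w ≡ run T′ w) →
    hits W P ≤ 2 * hits W (λ w → P w ∧ does (lookup w j Bool.≟ c)) → Conclusion T
  extend T T′ j c depth≤t T≡T′ half
    -- `P` is arbitrary so that the bit just read can be added to it before the recursive call.
    with π , b , constant , heavy ← heavy-path t T′ depth≤t W (λ w → P w ∧ does (lookup w j Bool.≟ c))
    = (j , c) ∷ π , b , constant′ , (begin
      hits W P
        ≤⟨ half ⟩
      2 * hits W (λ w → P w ∧ does (lookup w j Bool.≟ c))
        ≤⟨ *-monoʳ-≤ 2 heavy ⟩
      2 * (2 ^ t * hits W (λ w → (P w ∧ does (lookup w j Bool.≟ c)) ∧ follows π w))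
        ≡⟨ *-assoc 2 (2 ^ t) _ ⟨
      2 ^ suc t * hits W (λ w → (P w ∧ does (lookup w j Bool.≟ c)) ∧ follows π w)
        ≡⟨ cong (2 ^ suc t *_) (hits-cong W (λ w → Bool.∧-assoc (P w) _ (follows π w))) ⟩
      2 ^ suc t * hits W (λ w → P w ∧ follows ((j , c) ∷ π) w) ∎)
    where
    constant′ : ∀ w → follows ((j , c) ∷ π) w ≡ true → run T w ≡ b
    constant′ w followed with lookup w j Bool.≟ c
    ... | yes wⱼ≡c = trans (T≡T′ w wⱼ≡c) (constant w followed)
    ... | no  _    = contradiction followed λ ()

  go : ∀ T → depth T ≤ suc t → Conclusion T
  -- The padding probe reads cell `zero`, which exists because the number of cells is a successor.
  go (answer b) _ with c , half ← majority W P zero =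
    extend (answer b) (answer b) zero c z≤n (λ _ _ → refl) half
  go (probe j T₀ T₁) (s≤s depth≤t) with majority W P j
  ... | false , half = extend (probe j T₀ T₁) T₀ j false
    (≤-trans (m≤m⊔n _ _) depth≤t) (λ w wⱼ≡0 → cong (if_then run T₁ w else run T₀ w) wⱼ≡0) half
  ... | true  , half = extend (probe j T₀ T₁) T₁ j true
    (≤-trans (m≤n⊔m (depth T₀) _) depth≤t) (λ w wⱼ≡1 → cong (if_then run T₁ w else run T₀ w) wⱼ≡1) half

-- Decoding the queries from the cells and counting the codes.

-- Filtering happens only at samples where `P` holds, and there `M` has the value `b`.
∈-restrict⁺ : ∀ {n N} {b M} {A : List (𝔽₂^ n)} (P : 𝔽₂^ n → Bool) →
  M ∈ A → (∀ x → P x ≡ true → ⟨ M , x ⟩ ≡ b) →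
  (xs : Vec (𝔽₂^ n) N) → M ∈ restrict b A xs (Vec.map P xs)
∈-restrict⁺ P M∈A M≡b []       = M∈A
∈-restrict⁺ P M∈A M≡b (x ∷ xs) with P x in Px
... | true  = ∈-restrict⁺ P (∈-filter⁺ _ M∈A (M≡b x Px)) M≡b xs
... | false = ∈-restrict⁺ P M∈A M≡b xs

hits-all : ∀ {s N} (W : Vec (Vec Bool s) N) → hits W (λ _ → true) ≡ N
hits-all []      = refl
hits-all (w ∷ W) = cong suc (hits-all W)

-- With `2 ^ t * r` samples, some path of length `t` is followed by at least `r` of them, which is
-- the size from which `light` applies.
module Counting {n : ℕ} (s t m r L : ℕ) (A : List (𝔽₂^ n)) (xs : Vec (𝔽₂^ n) (2 ^ t * r))
  (light : ∀ b J → r ≤ ∣ J ∣ → length (restrict b A xs J) ≤ L) where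

  labelled-paths : List (Path (suc s) t × Bool)
  labelled-paths = cartesianProduct (paths (suc s) t) bools

  -- The decoder sees the cell contents `W` on the samples, but neither the trees nor the queries.
  leaf-candidates : Vec (Vec Bool (suc s)) (2 ^ t * r) → Path (suc s) t × Bool → List (𝔽₂^ n)
  leaf-candidates W (π , b) with r ≤? hits W (follows π)
  ... | yes _ = restrict b A xs (Vec.map (follows π) W)
  -- `light` says nothing about a path with fewer than `r` samples; the empty list keeps the length
  -- bound unconditional.
  ... | no  _ = []

  leaf-candidates-length : ∀ W ℓ → length (leaf-candidates W ℓ) ≤ L
  leaf-candidates-length W (π , b) with r ≤? hits W (follows π)
  ... | yes heavy = light b _ heavy
  ... | no  _     = z≤n

  ∈-leaf-candidates : ∀ {M} W π b → r ≤ hits W (follows π) →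
    M ∈ restrict b A xs (Vec.map (follows π) W) → M ∈ leaf-candidates W (π , b)
  ∈-leaf-candidates W π b heavy M∈ with r ≤? hits W (follows π)
  ... | yes _     = M∈
  ... | no  light = contradiction heavy light

  candidates : Vec (Vec Bool (suc s)) (2 ^ t * r) → List (𝔽₂^ n)
  candidates W = concatMap (leaf-candidates W) labelled-paths

  candidates-length : ∀ W → length (candidates W) ≤ (suc s * 2) ^ t * 2 * L
  candidates-length W = ≤-trans (length-concatMap-≤ _ (leaf-candidates-length W) labelled-paths)
    (≤-reflexive (cong (_* L) (trans
      (length-cartesianProductWith _,_ (paths (suc s) t) bools)
      (cong (_* 2) (length-paths (suc s) t)))))

  -- All `m` queries share one `W`. Hence the number of cell contents enters the count once, and
  -- only the choice of path, answer and index is raised to the power `m`.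
  decodable : List (Vec (𝔽₂^ n) m)
  decodable = concatMap (λ W → tuples (candidates W) m) (tuples (points (suc s)) (2 ^ t * r))

  decodable-length : length decodable ≤ (2 ^ suc s) ^ (2 ^ t * r) * ((suc s * 2) ^ t * 2 * L) ^ m
  decodable-length = ≤-trans
    (length-concatMap-≤ _ (λ W → ≤-trans (≤-reflexive (length-tuples (candidates W) m))
      (^-monoˡ-≤ m (candidates-length W))) (tuples (points (suc s)) (2 ^ t * r)))
    (≤-reflexive (cong (_* ((suc s * 2) ^ t * 2 * L) ^ m)
      (trans (length-tuples (points (suc s)) (2 ^ t * r))
        (cong (_^ (2 ^ t * r)) (length-points (suc s))))))

  module _ {v : Vec (𝔽₂^ n) m} (v⊆A : ∀ i → lookup v i ∈ A)
           (ds : DataStructure (lookup v) (suc s) t) where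

    open DataStructure ds

    cells : Vec (Vec Bool (suc s)) (2 ^ t * r)
    cells = Vec.map preprocess xs

    -- On the samples that follow a heavy path in its tree, query `i` equals the answer there by
    -- correctness, so it survives the restriction to them.
    ∈-candidates : ∀ i → lookup v i ∈ candidates cells
    ∈-candidates i with π , b , constant , heavy ← heavy-path t (tree i) (depth≤t i) cells (λ _ → true) =
      ∈-concatMap⁺ (leaf-candidates cells) (lose
        (∈-cartesianProduct⁺ (∈-paths π) (∈-bools b))
        (∈-leaf-candidates cells π b
          (*-cancelˡ-≤ (2 ^ t) {{m^n≢0 2 t}} (subst (_≤ 2 ^ t * hits cells (follows π)) (hits-all cells) heavy))
          (subst (λ J → lookup v i ∈ restrict b A xs J) (Vec.map-∘ (follows π) preprocess xs)
            (∈-restrict⁺ (follows π ∘ preprocess) (v⊆A i)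
              (λ x followed → trans (sym (correct x i)) (constant (preprocess x) followed)) xs))))

    ∈-decodable : v ∈ decodable
    ∈-decodable = ∈-concatMap⁺ (λ W → tuples (candidates W) m) (lose
      (∈-tuples⁺ cells (λ j → ∈-tuples⁺ (lookup cells j) (λ _ → ∈-bools _)))
      (∈-tuples⁺ v ∈-candidates))

  -- By pigeonhole some tuple over `A` is not decodable, whereas a data structure for it would
  -- decode it.
  hard-queries : Unique A →
    (2 ^ suc s) ^ (2 ^ t * r) * ((suc s * 2) ^ t * 2 * L) ^ m < length A ^ m →
    Σ[ Q ∈ (Fin m → 𝔽₂^ n) ] (∀ i → Q i ∈ A) × ¬ DataStructure Q (suc s) t
  hard-queries A! few
    with v , v∈ , v∉ ← unique-∉ (Vec.≡-dec (Vec.≡-dec Bool._≟_)) (tuples-unique A! m) decodable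
      (<-≤-trans (≤-<-trans decodable-length few) (≤-reflexive (sym (length-tuples A m))))
    = lookup v , v⊆A , λ ds → v∉ (∈-decodable v⊆A ds)
    where
    v⊆A = ∈-tuples⁻ v v∈

-- Choice of the parameters and the asymptotic statement.

n<2^n : ∀ n → n < 2 ^ n
n<2^n zero    = s≤s z≤n
n<2^n (suc n) = begin-strict
  suc n            ≤⟨ n<2^n n ⟩
  2 ^ n            <⟨ m<m+n (2 ^ n) (m^n>0 2 n) ⟩
  2 ^ n + 2 ^ n    ≡⟨ cong (2 ^ n +_) (+-identityʳ (2 ^ n)) ⟨
  2 ^ suc n        ∎
  where open ≤-Reasoning

-- The exponent serves as log s rounded up: large enough to address the cells, with a loss of at
-- most a factor 2.
power-of-two-above : ∀ n → ∃ λ g → suc n ≤ 2 ^ g × 2 ^ g ≤ 2 * suc n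
power-of-two-above zero    = 0 , ≤-refl , s≤s z≤n
power-of-two-above (suc n) with g , n<2^g , 2^g≤2n ← power-of-two-above n with suc (suc n) ≤? 2 ^ g
... | yes n+1<2^g = g , n+1<2^g , ≤-trans 2^g≤2n (*-monoʳ-≤ 2 (n≤1+n (suc n)))
... | no  n+1≮2^g = suc g ,
  ≤-trans (+-monoʳ-≤ 1 (m≤n+m (suc n) n))
    (≤-trans (≤-reflexive (cong (suc n +_) (sym (+-identityʳ (suc n))))) (*-monoʳ-≤ 2 n<2^g)) ,
  *-monoʳ-≤ 2 (<⇒≤ (≰⇒> n+1≮2^g))

-- The factor 6 is the least integer exponent for which the power of 8/7 reaches 2.
2^e*7^6e≤8^6e : ∀ e → 2 ^ e * 7 ^ (6 * e) ≤ 8 ^ (6 * e)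
2^e*7^6e≤8^6e e = begin
  2 ^ e * 7 ^ (6 * e)     ≡⟨ cong (2 ^ e *_) (^-*-assoc 7 6 e) ⟨
  2 ^ e * (7 ^ 6) ^ e     ≡⟨ ^-distribʳ-* 2 (7 ^ 6) e ⟨
  (2 * 7 ^ 6) ^ e         ≤⟨ ^-monoˡ-≤ e (≤ᵇ⇒≤ (2 * 7 ^ 6) (8 ^ 6) _) ⟩
  (8 ^ 6) ^ e             ≡⟨ ^-*-assoc 8 6 e ⟩
  8 ^ (6 * e)             ∎
  where open ≤-Reasoning

-- Sampling with `k = 2 ^ t` and r = κp produces exactly as many samples as the counting expects,
-- with at most 2q candidates per leaf.
hard-queries-if-few : ∀ {q D} s t m κ p
  .{{_ : NonZero q}} .{{_ : NonZero D}} .{{_ : NonZero p}} .{{_ : NonZero s}} →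
  q * 7 ^ p ≤ 8 ^ p → 16 * D ≤ q → 2 * 2 ^ t ≤ D →
  (2 ^ s) ^ (2 ^ t * (κ * p)) * ((s * 2) ^ t * 2 * (2 * q)) ^ m < (2 ^ κ) ^ m →
  ∀ {n} {A : List (𝔽₂^ n)} → Unique A → length A ≡ 2 ^ κ →
  Σ[ Q ∈ (Fin m → 𝔽₂^ n) ] (∀ i → Q i ∈ A) × ¬ DataStructure Q s t
hard-queries-if-few {q} {D} (suc s) t m κ p shrink 16D≤q 2^[1+t]≤D few {A = A} A! ∣A∣
  = let xs , light = Sampling.∃-sample q p shrink 16D≤q (2 ^ t) κ 2^[1+t]≤D A! ∣A∣ in
    Counting.hard-queries s t m (κ * p) (2 * q) A xs (λ b J r≤∣J∣ → <⇒≤ (light b J r≤∣J∣)) A!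
      (<-≤-trans few (≤-reflexive (cong (_^ m) (sym ∣A∣))))

16*2^[1+t]≡2^[5+t] : ∀ t → 16 * 2 ^ (1 + t) ≡ 2 ^ (5 + t)
16*2^[1+t]≡2^[5+t] t = nested (2 ^ t)
  where
  nested : ∀ x → 16 * (2 * x) ≡ 2 * (2 * (2 * (2 * (2 * x))))
  nested = solve-∀

module _ (t s m g : ℕ) (7≤t : 7 ≤ t) (2≤s : 2 ≤ s) (s≤2^g : s ≤ 2 ^ g)
         (m-large : 32 * (s * 2 ^ (5 * t)) ≤ m) where

  private
    κ p q r N c : ℕ
    -- Per query, path, answer and index take at most 4gt bits and the share of the cells at most
    -- 3gt; 8gt exceeds their sum.
    κ = g * (t * 8)
    p = 6 * (5 + t)
    -- This is 16D for D = `2 ^ suc t`, twice the number `2 ^ t` required by `∃-sample`.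
    q = 2 ^ (5 + t)
    r = κ * p
    N = 2 ^ t * r
    -- Each of the `t` probes takes g + 1 bits, the answer one, and an index below 2q the remaining
    -- 6 + t.
    c = (g + 1) * t + (7 + t)

    1≤g : 1 ≤ g
    1≤g = n≢0⇒n>0 λ where refl → contradiction (≤-trans 2≤s s≤2^g) λ { (s≤s ()) }

    0<m : 0 < m
    0<m = <-≤-trans (*-mono-≤ {1} {32} (s≤s z≤n) (*-mono-≤ {1} {s} (<⇒≤ 2≤s) (m^n>0 2 (5 * t)))) m-large

    0<gtm : 0 < g * t * m
    0<gtm = *-mono-≤ (*-mono-≤ 1≤g (≤-trans (s≤s z≤n) 7≤t)) 0<m

    instance
      s≢0 : NonZero s
      s≢0 = >-nonZero (<⇒≤ 2≤s)

    open ≤-Reasoning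

    candidates-bound : (s * 2) ^ t * 2 * (2 * q) ≤ 2 ^ c
    candidates-bound = begin
      (s * 2) ^ t * 2 * (2 * q)            ≤⟨ *-monoˡ-≤ (2 * q) (*-monoˡ-≤ 2 (^-monoˡ-≤ t (*-monoˡ-≤ 2 s≤2^g))) ⟩
      (2 ^ g * 2) ^ t * 2 * (2 * q)        ≡⟨ cong (λ z → z ^ t * 2 * (2 * q)) (^-distribˡ-+-* 2 g 1) ⟨
      (2 ^ (g + 1)) ^ t * 2 * (2 * q)      ≡⟨ cong (λ z → z * 2 * (2 * q)) (^-*-assoc 2 (g + 1) t) ⟩
      2 ^ ((g + 1) * t) * 2 * (2 * q)      ≡⟨ *-assoc (2 ^ ((g + 1) * t)) 2 (2 * q) ⟩
      2 ^ ((g + 1) * t) * 2 ^ (7 + t)      ≡⟨ ^-distribˡ-+-* 2 ((g + 1) * t) (7 + t) ⟨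
      2 ^ c                                ∎

    c≤4gt : c ≤ 4 * (g * t)
    c≤4gt = begin
      (g + 1) * t + (7 + t)          ≤⟨ +-monoʳ-≤ ((g + 1) * t) (+-monoˡ-≤ t 7≤t) ⟩
      (g + 1) * t + (t + t)          ≡⟨ collect g t ⟩
      g * t + 3 * (1 * t)            ≤⟨ +-monoʳ-≤ (g * t) (*-monoʳ-≤ 3 (*-monoˡ-≤ t 1≤g)) ⟩
      4 * (g * t)                    ∎
      where
      collect : ∀ g t → (g + 1) * t + (t + t) ≡ g * t + 3 * (1 * t)
      collect = solve-∀

    sN≤3gtm : s * N ≤ 3 * (g * t * m)
    sN≤3gtm = begin
      s * (2 ^ t * (g * (t * 8) * (6 * (5 + t))))
        ≡⟨ regroup s (2 ^ t) g t ⟩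
      3 * (g * t * (16 * (s * 2 ^ t * (5 + t))))
        -- As 5 + t is at most twice `2 ^ t`, the factor 16 becomes the 32 of `m-large`.
        ≤⟨ *-monoʳ-≤ 3 (*-monoʳ-≤ (g * t) (≤-trans samples m-large)) ⟩
      3 * (g * t * m) ∎
      where
      regroup : ∀ s y g t → s * (y * (g * (t * 8) * (6 * (5 + t)))) ≡ 3 * (g * t * (16 * (s * y * (5 + t))))
      regroup = solve-∀
      double : ∀ s y → 16 * (s * y * (y + y)) ≡ 32 * (s * (y * y))
      double = solve-∀
      twice : ∀ t → t + t + 3 * t ≡ 5 * t
      twice = solve-∀
      samples : 16 * (s * 2 ^ t * (5 + t)) ≤ 32 * (s * 2 ^ (5 * t))
      samples = begin
        16 * (s * 2 ^ t * (5 + t))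
          ≤⟨ *-monoʳ-≤ 16 (*-monoʳ-≤ (s * 2 ^ t) (+-mono-≤
               (≤-trans (≤-trans (m≤n+m 5 2) 7≤t) (<⇒≤ (n<2^n t))) (<⇒≤ (n<2^n t)))) ⟩
        16 * (s * 2 ^ t * (2 ^ t + 2 ^ t))
          ≡⟨ double s (2 ^ t) ⟩
        32 * (s * (2 ^ t * 2 ^ t))
          ≡⟨ cong (λ z → 32 * (s * z)) (^-distribˡ-+-* 2 t t) ⟨
        32 * (s * 2 ^ (t + t))
          ≤⟨ *-monoʳ-≤ 32 (*-monoʳ-≤ s (^-monoʳ-≤ 2 (≤-trans (m≤m+n (t + t) (3 * t)) (≤-reflexive (twice t))))) ⟩
        32 * (s * 2 ^ (5 * t)) ∎

    exponents : s * N + c * m < κ * m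
    exponents = begin-strict
      s * N + c * m                           ≤⟨ +-mono-≤ sN≤3gtm (*-monoˡ-≤ m c≤4gt) ⟩
      3 * (g * t * m) + 4 * (g * t) * m       ≡⟨ cong (3 * (g * t * m) +_) (*-assoc 4 (g * t) m) ⟩
      3 * (g * t * m) + 4 * (g * t * m)       ≡⟨ *-distribʳ-+ (g * t * m) 3 4 ⟨
      7 * (g * t * m)                         <⟨ m<n+m (7 * (g * t * m)) 0<gtm ⟩
      8 * (g * t * m)                         ≡⟨ regroup g t m ⟩
      g * (t * 8) * m                         ∎
      where
      regroup : ∀ g t m → 8 * (g * t * m) ≡ g * (t * 8) * m
      regroup = solve-∀

    few-decodable : (2 ^ s) ^ N * ((s * 2) ^ t * 2 * (2 * q)) ^ m < (2 ^ κ) ^ m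
    few-decodable = begin-strict
      (2 ^ s) ^ N * ((s * 2) ^ t * 2 * (2 * q)) ^ m  ≤⟨ *-monoʳ-≤ ((2 ^ s) ^ N) (^-monoˡ-≤ m candidates-bound) ⟩
      (2 ^ s) ^ N * (2 ^ c) ^ m                      ≡⟨ cong₂ _*_ (^-*-assoc 2 s N) (^-*-assoc 2 c m) ⟩
      2 ^ (s * N) * 2 ^ (c * m)                      ≡⟨ ^-distribˡ-+-* 2 (s * N) (c * m) ⟨
      2 ^ (s * N + c * m)                            <⟨ ^-monoʳ-< 2 (s≤s (s≤s z≤n)) exponents ⟩
      2 ^ (κ * m)                                    ≡⟨ ^-*-assoc 2 κ m ⟨
      (2 ^ κ) ^ m                                    ∎

  hard-queries-in-power-of-two : ∀ {n} {A : List (𝔽₂^ n)} → Unique A → length A ≡ 2 ^ (g * (t * 8)) →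
    Σ[ Q ∈ (Fin m → 𝔽₂^ n) ] (∀ i → Q i ∈ A) × ¬ DataStructure Q s t
  hard-queries-in-power-of-two = hard-queries-if-few {q = q} {D = 2 ^ suc t} s t m κ p
    {{m^n≢0 2 (5 + t)}} {{m^n≢0 2 (suc t)}}
    (2^e*7^6e≤8^6e (5 + t)) (≤-reflexive (16*2^[1+t]≡2^[5+t] t)) ≤-refl few-decodable

-- From 2 ≤ s follows `2 ^ g ≤ 2 * s ≤ s ^ 2`, hence the exponent 16t. This ensures that `S` has at
-- least 2^κ vectors.
2^[g*8t]≤s^[t*10^4] : ∀ g t s .{{_ : NonZero s}} → 2 ≤ s → 2 ^ g ≤ 2 * s →
  2 ^ (g * (t * 8)) ≤ s ^ (t * 10 ^ 4)
2^[g*8t]≤s^[t*10^4] g t s 2≤s 2^g≤2s = begin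
  2 ^ (g * (t * 8))      ≡⟨ ^-*-assoc 2 g (t * 8) ⟨
  (2 ^ g) ^ (t * 8)      ≤⟨ ^-monoˡ-≤ (t * 8) (≤-trans 2^g≤2s (*-monoˡ-≤ s 2≤s)) ⟩
  (s * s) ^ (t * 8)      ≡⟨ cong (λ z → (s * z) ^ (t * 8)) (*-identityʳ s) ⟨
  (s ^ 2) ^ (t * 8)      ≡⟨ ^-*-assoc s 2 (t * 8) ⟩
  s ^ (2 * (t * 8))      ≡⟨ cong (s ^_) (regroup t) ⟩
  s ^ (t * 16)           ≤⟨ ^-monoʳ-≤ s (*-monoʳ-≤ t (≤ᵇ⇒≤ 16 (10 ^ 4) _)) ⟩
  s ^ (t * 10 ^ 4)       ∎
  where
  open ≤-Reasoning
  regroup : ∀ t → 2 * (t * 8) ≡ t * 16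
  regroup = solve-∀

hard-queries-exist : ∀ {n} t s m (S : List (𝔽₂^ n)) → Unique S →
  7 ≤ t → 2 ≤ s → 32 * (s * 2 ^ (5 * t)) ≤ m → log length S ≥ t * 10 ^ 4 ·log s →
  Σ[ Q ∈ (Fin m → 𝔽₂^ n) ] (∀ i → Q i ∈ S) × ¬ DataStructure Q s t
hard-queries-exist t s@(suc s′) m S S! 7≤t 2≤s m-large S-large
  = let g , s≤2^g , 2^g≤2s = power-of-two-above s′
        κ = g * (t * 8)
        Q , Q⊆A , hard = hard-queries-in-power-of-two t s m g 7≤t 2≤s s≤2^g m-large
          -- `S` is cut to length exactly 2^κ, so that the counting takes place entirely in
          -- exponents of 2.
          (take⁺ (2 ^ κ) S!)
          (trans (length-take (2 ^ κ) S)
            (m≤n⇒m⊓n≡m (≤-trans (2^[g*8t]≤s^[t*10^4] g t s 2≤s 2^g≤2s) S-large)))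
    in Q , (λ i → ⊆-lookup (take-⊆ (2 ^ κ) S) (Q⊆A i)) , hard

theorem1p3 : (n t s m : ℕ → ℕ) (S : ∀ k → List (𝔽₂^ (n k))) →
    (∀ k → Unique (S k)) →
    t ≥ω (λ _ → 1) → s ≥ω (λ _ → 1) → m ≥ω (λ _ → 1) →
    m ≥ω (λ k → s k * 2 ^ (5 * t k)) →
    (∀ k → log length (S k) ≥ t k * 10 ^ 4 ·log s k) →
    Eventually (λ k →
    Σ[ Q ∈ (Fin (m k) → 𝔽₂^ (n k)) ]
    (∀ i → Q i ∈ S k) × ¬ DataStructure Q (s k) (t k))
theorem1p3 n t s m S S! t→∞ s→∞ _ m≫ S-large
  -- Each limit is used at a single constant, the one required by `hard-queries-exist`.
  with Kₜ , 7≤t ← t→∞ 7 | Kₛ , 2≤s ← s→∞ 2 | Kₘ , m-large ← m≫ 32 =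
  Kₜ ⊔ Kₛ ⊔ Kₘ , λ k K≤k →
    hard-queries-exist (t k) (s k) (m k) (S k) (S! k)
      (7≤t k (≤-trans (≤-trans (m≤m⊔n Kₜ Kₛ) (m≤m⊔n (Kₜ ⊔ Kₛ) Kₘ)) K≤k))
      (2≤s k (≤-trans (≤-trans (m≤n⊔m Kₜ Kₛ) (m≤m⊔n (Kₜ ⊔ Kₛ) Kₘ)) K≤k))
      (m-large k (≤-trans (m≤n⊔m (Kₜ ⊔ Kₛ) Kₘ) K≤k))
      (S-large k)
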